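{- Let $k\ge 1$ be an integer. If a finite simple graph $G$ has no $K_{k+2}$-minor, then $G$ has a $\Lambda_{\mathrm{odd}}$-selector of width $k$, where $\Lambda_{\mathrm{odd}}=\{1,3,5,\ldots\}$ is the set of odd positive integers.
   Context: All graphs are finite and simple. $N_G[x]$ denotes the closed neighborhood of $x$ in $G$, and $[p]=\{1,\ldots,p\}$. A graph $H$ is a minor of $G$ if $H$ can be obtained from $G$ by deleting edges and/or vertices and contracting edges. For a set $\Lambda$ of positive integers with $1\in\Lambda$, a $\Lambda$-selector of width $p$ in $G$ is a pair $(S,\varphi)$ consisting of an independent set $S\subseteq V(G)$ and a map $\varphi:S\to[p]$ such that, for every $x\in V(G)$, there is a color $i\in[p]$ with $|N_G[x]\cap\varphi^{ -1}(i)|\in\Lambda$. -}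

module Defs where

open import Level using (0ℓ)
open import Data.Fin using (Fin; punchIn; _≟_)
open import Data.Fin.Subset using (Subset; _∈_; _∩_; ∣_∣)
open import Data.Fin.Subset.Properties using (_∈?_)
open import Data.Nat using (ℕ; suc; _*_; _≤_; z≤n; s≤s)
open import Data.Product using (Σ; ∃; _×_; _,_; swap)
open import Data.Sum using (_⊎_)
import Data.Sum as Sum
open import Data.Vec using (tabulate)
open import Data.Vec.Properties.WithK using ([]=-irrelevant)
open import Function using (_∘_)
open import Function.Bundles using (_↔_; _⇔_; module Inverse)
open import Relation.Binary using (Rel; Decidable; Symmetric; Irreflexive)
open import Relation.Binary.PropositionalEquality
  using (_≡_; _≢_; refl; sym; cong; subst)
open import Relation.Nullary using (yes; no; does; ¬_; ¬?; _×-dec_; _⊎-dec_)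
open import Relation.Nullary.Decidable using (map′)
import Relation.Unary as U

private
  variable
    m n : ℕ

-- A finite simple graph on the vertex set Fin n.  Adjacency is required to be
-- decidable, which is automatic classically.
record Graph (n : ℕ) : Set₁ where
  infix 4 _~_ _~?_
  field
    _~_      : Rel (Fin n) 0ℓ
    _~?_     : Decidable _~_
    ~-sym    : Symmetric _~_
    ~-irrefl : Irreflexive _≡_ _~_

record _≅_ (G : Graph m) (H : Graph n) : Set where
  private
    module G = Graph G
    module H = Graph H
  field
    bijection : Fin m ↔ Fin n
  open Inverse bijection using (to)
  field
    preserves : ∀ x y → x G.~ y ⇔ to x H.~ to y

K : ∀ n → Graph n
K n = record
  { _~_      = _≢_
  ; _~?_     = λ x y → ¬? (x ≟ y)
  ; ~-sym    = λ x≢y → x≢y ∘ sym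
  ; ~-irrefl = λ x≡y x≢y → x≢y x≡y
  }

-- {x , y} = {u , v} as unordered pairs.
SamePair : (u v x y : Fin n) → Set
SamePair u v x y = (x ≡ u × y ≡ v) ⊎ (x ≡ v × y ≡ u)

deleteEdge : Graph n → (u v : Fin n) → Graph n
deleteEdge G u v = record
  { _~_      = λ x y → x ~ y × ¬ SamePair u v x y
  ; _~?_     = λ x y → (x ~? y) ×-dec
                 ¬? (((x ≟ u) ×-dec (y ≟ v)) ⊎-dec ((x ≟ v) ×-dec (y ≟ u)))
  ; ~-sym    = λ (x~y , xy≢uv) →
                 ~-sym x~y , xy≢uv ∘ Sum.swap ∘ Sum.map swap swap
  ; ~-irrefl = λ x≡y (x~y , _) → ~-irrefl x≡y x~y
  }
  where open Graph G

-- punchIn v enumerates the vertices other than v.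
deleteVertex : Graph (suc n) → Fin (suc n) → Graph n
deleteVertex G v = record
  { _~_      = λ x y → punchIn v x ~ punchIn v y
  ; _~?_     = λ x y → punchIn v x ~? punchIn v y
  ; ~-sym    = ~-sym
  ; ~-irrefl = λ x≡y → ~-irrefl (cong (punchIn v) x≡y)
  }
  where open Graph G

-- Contraction of the edge uv: the vertex v is removed and the vertex u stands
-- for the merged vertex, so it is adjacent to the former neighbours of u and
-- of v.  The condition x ≢ y discards the loop at u.
contract : Graph (suc n) → (u v : Fin (suc n)) → Graph n
contract {n} G u v = record
  { _~_      = λ x y → x ≢ y × Merged (punchIn v x) (punchIn v y)
  ; _~?_     = λ x y → ¬? (x ≟ y) ×-dec merged? (punchIn v x) (punchIn v y)
  ; ~-sym    = λ (x≢y , a) → x≢y ∘ sym , merged-sym a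
  ; ~-irrefl = λ x≡y (x≢y , _) → x≢y x≡y
  }
  where
  open Graph G

  Merged : Rel (Fin (suc n)) 0ℓ
  Merged x y = x ~ y ⊎ (x ≡ u × v ~ y) ⊎ (y ≡ u × v ~ x)

  merged? : Decidable Merged
  merged? x y =
    (x ~? y) ⊎-dec (((x ≟ u) ×-dec (v ~? y)) ⊎-dec ((y ≟ u) ×-dec (v ~? x)))

  merged-sym : Symmetric Merged
  merged-sym = Sum.map ~-sym Sum.swap

-- H ≼ G: H is a minor of G.
infix 4 _≼_
data _≼_ {m : ℕ} (H : Graph m) : {n : ℕ} → Graph n → Set₁ where
  isomorphic     : {G : Graph n} → H ≅ G → H ≼ G
  edge-deleted   : {G : Graph n} (u v : Fin n) → Graph._~_ G u v →
                   H ≼ deleteEdge G u v → H ≼ G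
  vertex-deleted : {G : Graph (suc n)} (v : Fin (suc n)) →
                   H ≼ deleteVertex G v → H ≼ G
  contracted     : {G : Graph (suc n)} (u v : Fin (suc n)) → Graph._~_ G u v →
                   H ≼ contract G u v → H ≼ G

-- The set of all x satisfying P x.
⟦_⟧ : {P : U.Pred (Fin n) 0ℓ} → U.Decidable P → Subset n
⟦ P? ⟧ = tabulate (does ∘ P?)

N[_,_] : Graph n → Fin n → Subset n
N[ G , x ] = ⟦ (λ y → (y ≟ x) ⊎-dec Graph._~?_ G x y) ⟧

Independent : Graph n → Subset n → Set
Independent G S = ∀ {x y} → x ∈ S → y ∈ S → ¬ (Graph._~_ G x y)

-- A map S → [p], with Fin p for the colour set [p].  Membership in a Subset is
-- proof-irrelevant, so φ x does not depend on the membership proof.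
Colouring : Subset n → ℕ → Set
Colouring S p = ∀ x → x ∈ S → Fin p

preimage? : {S : Subset n} {p : ℕ} (φ : Colouring S p) (i : Fin p) →
            U.Decidable (λ x → Σ (x ∈ S) λ x∈S → φ x x∈S ≡ i)
preimage? {S = S} φ i x with x ∈? S
... | no  x∉S = no λ (x∈S , _) → x∉S x∈S
... | yes x∈S = map′ (x∈S ,_)
  (λ (x∈S′ , eq) → subst (λ q → φ x q ≡ i) ([]=-irrelevant x∈S′ x∈S) eq)
  (φ x x∈S ≟ i)

preimage : {S : Subset n} {p : ℕ} → Colouring S p → Fin p → Subset n
preimage φ i = ⟦ preimage? φ i ⟧

-- A set of positive integers containing 1.
record SizeSet : Set₁ where
  field
    Member   : U.Pred ℕ 0ℓ
    positive : ∀ {l} → Member l → 1 ≤ l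
    one      : Member 1

record Selector (Λ : SizeSet) (p : ℕ) (G : Graph n) : Set where
  field
    S           : Subset n
    independent : Independent G S
    φ           : Colouring S p
    selects     : ∀ x → ∃ λ i →
                  SizeSet.Member Λ ∣ N[ G , x ] ∩ preimage φ i ∣

Λodd : SizeSet
Λodd = record
  { Member   = λ l → ∃ λ j → l ≡ suc (2 * j)
  ; positive = λ { (_ , refl) → s≤s z≤n }
  ; one      = 0 , refl
  }

{-# OPTIONS --safe #-}
module Submission where

-- Induction on the number of colours.  Let r be a vertex of G and grow a set
-- S ∋ r by adding vertices at distance exactly three from S for as long as
-- possible.  Every vertex of N[S] sees exactly one vertex of S, N[S] is
-- connected, and the component of r consists of N[S] and the set L of vertices
-- adjacent to N[S].  Contracting N[S] gives a vertex adjacent to all of L, so L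
-- has no K (k + 1)-minor if G has no K (k + 2)-minor.  Hence S may be given one
-- colour of its own, the other colours are used on L, and the remaining
-- components are independent of this one.
--
-- With one colour left the graph is a forest.  Consider the independent sets of
-- a tree with root r that satisfy all vertices other than r; such a set may
-- contain r, or miss r and meet N[r] in an odd, or in an even number of
-- vertices.  At least two of these three situations occur, by induction on the
-- tree: cut an edge at r and join the solutions on both sides.  Hence one of
-- the first two, in which r is satisfied as well, occurs.

open import Level using (0ℓ)
open import Data.Bool using (Bool; true; false; not; _xor_)
open import Data.Bool.Properties using (not-distribˡ-xor; not-distribʳ-xor)
import Data.Empty as Empty
open import Data.Fin using (Fin; zero; suc; punchIn; punchOut; _≟_)
open import Data.Fin.Properties
  using (any?; punchIn-injective; punchInᵢ≢i; punchIn-punchOut)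
open import Data.Fin.Subset
open import Data.Fin.Subset.Properties
open import Data.Fin.Subset.Induction using (⊂-wellFounded; ⊃-wellFounded)
open import Data.Maybe using (Maybe; just; nothing)
import Data.Maybe as Maybe
open import Data.Maybe.Properties using (just-injective)
import Data.Maybe.Properties as Maybeₚ
open import Data.Nat using (ℕ; zero; suc; _+_; _*_; _≤_)
open import Data.Nat.Properties using (+-suc)
open import Data.Product using (∃; ∃₂; _×_; _,_; proj₁; proj₂)
open import Data.Sum using (_⊎_; inj₁; inj₂)
import Data.Sum as Sum
import Data.Unit as Unit
open import Data.Vec using ([]; _∷_; here; there)
open import Data.Vec.Properties using (lookup∘tabulate; lookup⇒[]=; []=⇒lookup)
open import Function using (_∘_; id)
open import Function.Bundles using (_⇔_; mk⇔; mk↔ₛ′; module Equivalence)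
open import Function.Construct.Symmetry using (⇔-sym)
open import Induction.WellFounded using (Acc; acc)
open import Relation.Binary using (Rel)
open import Relation.Binary.Construct.Closure.ReflexiveTransitive
  using (Star; ε; _◅_; kleisliStar)
import Relation.Binary.Construct.Closure.ReflexiveTransitive as Star
open import Relation.Binary.PropositionalEquality
  using (_≡_; _≢_; refl; sym; trans; cong; subst)
open import Relation.Nullary
open import Relation.Nullary.Decidable using (dec-true)
import Relation.Unary as U
open import Defs

open Equivalence using (to; from)

private
  variable
    m n : ℕ

-- Subsets cut out by decidable predicates.

∈⟦⟧ : {P : U.Pred (Fin n) 0ℓ} (P? : U.Decidable P) {x : Fin n} →
      x ∈ ⟦ P? ⟧ ⇔ P x
∈⟦⟧ {n} {P} P? {x} = mk⇔
  (λ x∈ → holds (P? x) (trans (sym (lookup∘tabulate _ x)) ([]=⇒lookup x∈)))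
  (λ px → lookup⇒[]= x _ (trans (lookup∘tabulate _ x) (dec-true (P? x) px)))
  where
  holds : (d : Dec (P x)) → does d ≡ true → P x
  holds (yes px) _ = px

x∈p─q⇒x∉q : (p q : Subset n) {x : Fin n} → x ∈ p ─ q → x ∉ q
x∈p─q⇒x∉q (_ ∷ p) (false ∷ q) here      ()
x∈p─q⇒x∉q (_ ∷ p) (_ ∷ q)     (there a) (there b) = x∈p─q⇒x∉q p q a b

x∈p-y⁻ : ∀ (p : Subset n) {x y} → x ∈ p - y → x ∈ p × x ≢ y
x∈p-y⁻ p {y = y} x∈ =
  p─q⊆p p ⁅ y ⁆ x∈ , λ { refl → x∈p─q⇒x∉q p ⁅ y ⁆ x∈ (x∈⁅x⁆ y) }

-- Partial labellings with one more label.

module _ {D : U.Pred (Fin n) 0ℓ} (D? : U.Decidable D) (f : Fin n → Maybe (Fin m))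
  where

  -- Serves twice: for a new branch set of a minor model and for a new colour class.
  adjoin : Fin n → Maybe (Fin (suc m))
  adjoin x with D? x
  ... | yes _ = just zero
  ... | no  _ = Maybe.map suc (f x)

  adjoin-zero : ∀ {x} → adjoin x ≡ just zero ⇔ D x
  adjoin-zero {x} with D? x
  ... | yes dx = mk⇔ (λ _ → dx) (λ _ → refl)
  ... | no ¬dx with f x
  ...   | just _  = mk⇔ (λ ()) (λ dx → contradiction dx ¬dx)
  ...   | nothing = mk⇔ (λ ()) (λ dx → contradiction dx ¬dx)

  adjoin-suc : (∀ {x i} → f x ≡ just i → ¬ D x) →
               ∀ {x i} → adjoin x ≡ just (suc i) ⇔ f x ≡ just i
  adjoin-suc fresh {x} with D? x
  ... | yes dx = mk⇔ (λ ()) (λ eq → contradiction dx (fresh eq))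
  ... | no  _ with f x
  ...   | just _  = mk⇔ (λ { refl → refl }) (λ { refl → refl })
  ...   | nothing = mk⇔ (λ ()) (λ ())

-- Parity of subsets.

-- Computed in `Bool`, so that disjoint unions become `xor`; `odd-size` returns to cardinalities at
-- the very end.
parity : Subset n → Bool
parity []      = false
parity (b ∷ p) = b xor parity p

parity-⊥ : parity (⊥ {n}) ≡ false
parity-⊥ {zero}  = refl
parity-⊥ {suc n} = parity-⊥ {n}

parity-⁅⁆ : (x : Fin n) → parity ⁅ x ⁆ ≡ true
parity-⁅⁆ {suc n} zero    = cong not (parity-⊥ {n})
parity-⁅⁆         (suc x) = parity-⁅⁆ x

parity-∪ : (p q : Subset n) → (∀ {x} → x ∈ p → x ∉ q) →
           parity (p ∪ q) ≡ parity p xor parity q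
parity-∪ []          []          _    = refl
parity-∪ (true ∷ p)  (true ∷ q)  disj = contradiction here (disj here)
parity-∪ (true ∷ p)  (false ∷ q) disj = trans
  (cong not (parity-∪ p q (λ x∈p x∈q → disj (there x∈p) (there x∈q))))
  (not-distribˡ-xor (parity p) _)
parity-∪ (false ∷ p) (true ∷ q)  disj = trans
  (cong not (parity-∪ p q (λ x∈p x∈q → disj (there x∈p) (there x∈q))))
  (not-distribʳ-xor (parity p) _)
parity-∪ (false ∷ p) (false ∷ q) disj =
  parity-∪ p q (λ x∈p x∈q → disj (there x∈p) (there x∈q))

mutual
  even-size : (p : Subset n) → parity p ≡ false → ∃ λ j → ∣ p ∣ ≡ 2 * j
  even-size []          _ = 0 , refl
  even-size (false ∷ p) e = even-size p e
  even-size (true ∷ p)  e with parity p in odd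
  ... | true with odd-size p odd
  ...   | j , eq = suc j , trans (cong suc eq) (cong suc (sym (+-suc j (j + 0))))

  odd-size : (p : Subset n) → parity p ≡ true → ∃ λ j → ∣ p ∣ ≡ suc (2 * j)
  odd-size (false ∷ p) o = odd-size p o
  odd-size (true ∷ p)  o with parity p in even
  ... | false with even-size p even
  ...   | j , eq = j , cong suc eq

-- Odd is true, even is false.
Parity : Bool → U.Pred (Fin n) 0ℓ → Set
Parity b P = ∃ λ p → (∀ {x} → x ∈ p ⇔ P x) × parity p ≡ b

Parity-≡ : ∀ {a b} {P : U.Pred (Fin n) 0ℓ} → a ≡ b → Parity a P → Parity b P
Parity-≡ refl odd = odd

module _ {P Q : U.Pred (Fin n) 0ℓ} where

  Parity-cong : ∀ {b} → (∀ {x} → P x ⇔ Q x) → Parity b P → Parity b Q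
  Parity-cong P⇔Q (p , p⇔P , eq) = 
    p , mk⇔ (to P⇔Q ∘ to p⇔P) (from p⇔P ∘ from P⇔Q) , eq

  Parity-⊎ : ∀ {a b} → (∀ {x} → P x → ¬ Q x) → Parity a P → Parity b Q →
             Parity (a xor b) (λ x → P x ⊎ Q x)
  Parity-⊎ disj (p , p⇔P , refl) (q , q⇔Q , refl) =
    p ∪ q ,
    mk⇔ (Sum.map (to p⇔P) (to q⇔Q) ∘ x∈p∪q⁻ p q)
        (x∈p∪q⁺ ∘ Sum.map (from p⇔P) (from q⇔Q)) ,
    parity-∪ p q (λ x∈p x∈q → disj (to p⇔P x∈p) (to q⇔Q x∈q))

Parity-empty : {P : U.Pred (Fin n) 0ℓ} → (∀ {x} → ¬ P x) → Parity false P
Parity-empty {n} ¬P =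
  ⊥ , mk⇔ (λ x∈⊥ → contradiction x∈⊥ ∉⊥) (λ px → contradiction px ¬P) ,
  parity-⊥ {n}

Parity-singleton : {P : U.Pred (Fin n) 0ℓ} {s : Fin n} →
                   P s → (∀ {x} → P x → x ≡ s) → Parity true P
Parity-singleton {s = s} ps only =
  ⁅ s ⁆ ,
  mk⇔ (λ x∈ → subst _ (sym (x∈⁅y⁆⇒x≡y s x∈)) ps)
      (λ px → subst (_∈ ⁅ s ⁆) (sym (only px)) (x∈⁅x⁆ s)) ,
  parity-⁅⁆ s

-- Complete minors as models with connected branch sets.

module _ (G : Graph n) where
  open Graph G

  -- Both ends of every step lie in `P`, while the trivial path says nothing about its vertex.
  Path : U.Pred (Fin n) 0ℓ → Rel (Fin n) 0ℓ
  Path P = Star λ x y → x ~ y × P x × P y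

  Connected : U.Pred (Fin n) 0ℓ → Set
  Connected P = ∃ λ r → P r × ∀ {x} → P x → Path P x r

  -- A model of the minor K m whose branch sets, the classes of the partial
  -- labelling, lie within P.
  record Model (m : ℕ) (P : U.Pred (Fin n) 0ℓ) : Set where
    field
      label     : Fin n → Maybe (Fin m)
      within    : ∀ {x i} → label x ≡ just i → P x
      connected : ∀ i → Connected (λ x → label x ≡ just i)
      touching  : ∀ {i j} → i ≢ j →
                  ∃₂ λ x y → x ~ y × label x ≡ just i × label y ≡ just j

module _ {P : U.Pred (Fin (suc n)) 0ℓ} (G : Graph (suc n)) (M : Model G m P) where
  open Graph G
  open Model M

  -- The branch sets avoid `v`, so they survive, with the paths inside them and the edges between
  -- them, in the enumeration by `punchIn v`.
  deleteVertex-model : ∀ {v} → label v ≡ nothing →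
                       Model (deleteVertex G v) m (λ _ → Unit.⊤)
  deleteVertex-model {v} unlabelled = record
    { label     = label ∘ punchIn v
    ; within    = λ _ → Unit.tt
    ; connected = λ i → let r , lr , path = connected i in
        restrict lr ,
        trans (cong label (punchIn-restrict lr)) lr ,
        λ lx → path′ (punchIn-restrict lr) refl (path lx)
    ; touching  = λ i≢j → let x , y , x~y , lx , ly = touching i≢j in
        restrict lx , restrict ly ,
        subst₂~ (sym (punchIn-restrict lx)) (sym (punchIn-restrict ly)) x~y ,
        trans (cong label (punchIn-restrict lx)) lx ,
        trans (cong label (punchIn-restrict ly)) ly
    }
    where
    avoids : ∀ {x i} → label x ≡ just i → v ≢ x
    avoids lx refl with () ← trans (sym lx) unlabelled

    restrict : ∀ {x i} → label x ≡ just i → Fin n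
    restrict lx = punchOut (avoids lx)

    punchIn-restrict : ∀ {x i} (lx : label x ≡ just i) →
                       punchIn v (restrict lx) ≡ x
    punchIn-restrict lx = punchIn-punchOut (avoids lx)

    subst₂~ : ∀ {x x′ y y′} → x ≡ x′ → y ≡ y′ → x ~ y → x′ ~ y′
    subst₂~ refl refl x~y = x~y

    -- The ends are tied to the smaller graph by equations, so that the induction can follow the
    -- path in `G`.
    path′ : ∀ {i x y x′ y′} → punchIn v y′ ≡ y → punchIn v x′ ≡ x →
            Path G (λ z → label z ≡ just i) x y →
            Path (deleteVertex G v) (λ z → label (punchIn v z) ≡ just i) x′ y′
    path′ {x′ = x′} {y′} refl eq ε
      rewrite punchIn-injective v x′ y′ eq = ε
    path′ y≡ refl ((x~z , lx , lz) ◅ p) =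
      (subst₂~ refl (sym z≡) x~z , lx , trans (cong label z≡) lz) ◅ path′ y≡ z≡ p
      where z≡ = punchIn-restrict lz

  -- Labels descend along the projection `π`, which sends `v` to the merged vertex. An edge within a
  -- branch set may collapse under `π`, so `step` maps it to a path of length at most one.
  contract-model : ∀ {u v} → u ~ v → label u ≡ label v →
                   Model (contract G u v) m (λ _ → Unit.⊤)
  contract-model {u} {v} u~v lu≡lv = record
    { label     = label′
    ; within    = λ _ → Unit.tt
    ; connected = λ i → let r , lr , path = connected i in
        π r , trans (label-π r) lr ,
        λ {x} lx → subst (λ y → Path G′ _ y (π r)) (π-punchIn x)
                     (kleisliStar π step (path lx))
    ; touching  = λ i≢j → let x , y , x~y , lx , ly = touching i≢j in
        π x , π y ,
        adjacent x~y (λ eq → i≢j (just-injective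
          (trans (sym (trans (label-π x) lx))
                 (trans (cong label′ eq) (trans (label-π y) ly))))) ,
        trans (label-π x) lx , trans (label-π y) ly
    }
    where
    G′ = contract G u v

    v≢u : v ≢ u
    v≢u v≡u = ~-irrefl (sym v≡u) u~v

    label′ : Fin n → Maybe (Fin m)
    label′ = label ∘ punchIn v

    π : Fin (suc n) → Fin n
    π x with v ≟ x
    ... | yes _   = punchOut v≢u
    ... | no  v≢x = punchOut v≢x

    label-π : ∀ x → label′ (π x) ≡ label x
    label-π x with v ≟ x
    ... | yes refl = trans (cong label (punchIn-punchOut v≢u)) lu≡lv
    ... | no  v≢x  = cong label (punchIn-punchOut v≢x)

    π-punchIn : ∀ x → π (punchIn v x) ≡ x
    π-punchIn x with v ≟ punchIn v x
    ... | yes eq  = contradiction (sym eq) (punchInᵢ≢i v x)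
    ... | no  v≢x = punchIn-injective v _ _ (punchIn-punchOut v≢x)

    adjacent : ∀ {x y} → x ~ y → π x ≢ π y → Graph._~_ G′ (π x) (π y)
    adjacent {x} {y} x~y πx≢πy with v ≟ x | v ≟ y
    ... | yes refl | yes refl = contradiction refl πx≢πy
    ... | yes refl | no v≢y
      rewrite punchIn-punchOut v≢u | punchIn-punchOut v≢y =
        πx≢πy , inj₂ (inj₁ (refl , x~y))
    ... | no v≢x | yes refl
      rewrite punchIn-punchOut v≢u | punchIn-punchOut v≢x =
        πx≢πy , inj₂ (inj₂ (refl , ~-sym x~y))
    ... | no v≢x | no v≢y
      rewrite punchIn-punchOut v≢x | punchIn-punchOut v≢y = πx≢πy , inj₁ x~y

    step : ∀ {i x y} → x ~ y × label x ≡ just i × label y ≡ just i →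
           Path G′ (λ z → label′ z ≡ just i) (π x) (π y)
    step {x = x} {y} (x~y , lx , ly) with π x ≟ π y
    ... | yes eq  = subst (Path G′ _ (π x)) eq ε
    ... | no  neq = (adjacent x~y neq , trans (label-π x) lx , trans (label-π y) ly) ◅ ε

-- A connected branch set without inner edges is a single vertex. All vertices are labelled, so the
-- labelling is a bijection, and `touching` supplies all adjacencies.
singletons⇒≼ : {P : U.Pred (Fin n) 0ℓ} (G : Graph n) (M : Model G m P) →
  let open Graph G; open Model M in
  (∀ x → label x ≢ nothing) → (∀ {x y} → x ~ y → label x ≢ label y) →
  K m ≼ G
singletons⇒≼ {n} {m} G M total proper = isomorphic record
  { bijection = mk↔ₛ′ root (proj₁ ∘ labelled)
      (λ x → sym (unique (proj₂ (labelled x))))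
      (λ i → just-injective (trans (sym (proj₂ (labelled (root i)))) (label-root i)))
  ; preserves = λ i j → mk⇔
      (λ i≢j → let x , y , x~y , lx , ly = touching i≢j in root-~ x~y lx ly)
      (λ ri~rj i≡j → ~-irrefl (cong root i≡j) ri~rj)
  }
  where
  open Graph G
  open Model M

  root : Fin m → Fin n
  root i = proj₁ (connected i)

  label-root : ∀ i → label (root i) ≡ just i
  label-root i = proj₁ (proj₂ (connected i))

  trivial : ∀ {i x y} → Path G (λ z → label z ≡ just i) x y → x ≡ y
  trivial ε                    = refl
  trivial ((x~z , lx , lz) ◅ _) = contradiction (trans lx (sym lz)) (proper x~z)

  unique : ∀ {i x} → label x ≡ just i → x ≡ root i
  unique {i} lx = trivial (proj₂ (proj₂ (connected i)) lx)

  labelled : ∀ x → ∃ λ i → label x ≡ just i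
  labelled x with label x in eq
  ... | just i  = i , refl
  ... | nothing = contradiction eq (total x)

  root-~ : ∀ {x y i j} → x ~ y → label x ≡ just i → label y ≡ just j →
           root i ~ root j
  root-~ x~y lx ly rewrite unique lx | unique ly = x~y

-- Delete unlabelled vertices and contract edges inside branch sets. Each operation lowers `n`; when
-- neither applies, the graph is complete.
model⇒≼ : {P : U.Pred (Fin n) 0ℓ} (G : Graph n) → Model G m P → K m ≼ G
model⇒≼ {zero}  G M = singletons⇒≼ G M (λ ()) (λ { {()} })
model⇒≼ {suc n} G M
  with any? (λ x → Maybeₚ.≡-dec _≟_ (Model.label M x) nothing)
... | yes (v , unlabelled) =
  vertex-deleted v (model⇒≼ _ (deleteVertex-model G M unlabelled))
... | no total
  with any? (λ u → any? λ v → Graph._~?_ G u v ×-dec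
               Maybeₚ.≡-dec _≟_ (Model.label M u) (Model.label M v))
...   | yes (u , v , u~v , lu≡lv) =
  contracted u v u~v (model⇒≼ _ (contract-model G M u~v lu≡lv))
...   | no proper =
  singletons⇒≼ G M (λ x eq → total (x , eq)) (λ x~y eq → proper (_ , _ , x~y , eq))

-- Closed neighbourhoods, paths and extension of models.

module _ (G : Graph n) where
  open Graph G

  Nb : Rel (Fin n) 0ℓ
  Nb x y = y ≡ x ⊎ x ~ y

  Nb? : ∀ x y → Dec (Nb x y)
  Nb? x y = (y ≟ x) ⊎-dec (x ~? y)

  Connected-cong : {P Q : U.Pred (Fin n) 0ℓ} → (∀ {x} → P x ⇔ Q x) →
                   Connected G P → Connected G Q
  Connected-cong P⇔Q (r , pr , path) =
    r , to P⇔Q pr ,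
    Star.map (λ (x~y , px , py) → x~y , to P⇔Q px , to P⇔Q py) ∘ path ∘ from P⇔Q

  Path-mono : {P Q : U.Pred (Fin n) 0ℓ} → (∀ {x} → P x → Q x) →
              ∀ {x y} → Path G P x y → Path G Q x y
  Path-mono P⊆Q = Star.map λ (x~y , px , py) → x~y , P⊆Q px , P⊆Q py

  exit-edge : {P Q : U.Pred (Fin n) 0ℓ} → U.Decidable Q → ∀ {x y} →
              Path G P x y → Q x → ¬ Q y →
              ∃₂ λ a b → a ~ b × P b × Q a × ¬ Q b
  exit-edge Q? ε qx ¬qy = contradiction qx ¬qy
  exit-edge Q? (_◅_ {j = z} (x~z , _ , pz) path) qx ¬qy with Q? z
  ... | yes qz = exit-edge Q? path qz ¬qy
  ... | no ¬qz = _ , z , x~z , pz , qx , ¬qz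

  Connected-singleton : ∀ {x} → Connected G (_≡ x)
  Connected-singleton {x} = x , refl , λ { refl → ε }

  empty-model : {P : U.Pred (Fin n) 0ℓ} → Model G 0 P
  empty-model = record
    { label     = λ _ → nothing
    ; within    = λ { {i = ()} }
    ; connected = λ ()
    ; touching  = λ { {i = ()} }
    }

  module _ {m : ℕ} {D L P : U.Pred (Fin n) 0ℓ} (M : Model G m L) where
    open Model M

    -- `D` becomes the branch set with label `zero`; the last hypothesis gives its edges to the old
    -- branch sets.
    extend-model : U.Decidable D → Connected G D →
      (∀ {x} → D x → ¬ L x) → (∀ {x} → D x → P x) → (∀ {x} → L x → P x) →
      (∀ i → ∃₂ λ d x → d ~ x × D d × label x ≡ just i) →
      Model G (suc m) P
    extend-model D? D-connected D∩L D⊆P L⊆P touches = record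
      { label     = label′
      ; within    = within′
      ; connected = λ where
          zero    → Connected-cong (⇔-sym (adjoin-zero D? label)) D-connected
          (suc i) → Connected-cong (⇔-sym (adjoin-suc D? label fresh)) (connected i)
      ; touching  = λ {i} {j} → touching′ i j
      }
      where
      label′ : Fin n → Maybe (Fin (suc m))
      label′ = adjoin D? label

      fresh : ∀ {x i} → label x ≡ just i → ¬ D x
      fresh lx dx = D∩L dx (within lx)

      within′ : ∀ {x i} → label′ x ≡ just i → P x
      within′ {i = zero}  eq = D⊆P (to (adjoin-zero D? label) eq)
      within′ {i = suc _} eq = L⊆P (within (to (adjoin-suc D? label fresh) eq))

      touching′ : ∀ i j → i ≢ j →
        ∃₂ λ x y → x ~ y × label′ x ≡ just i × label′ y ≡ just j
      touching′ zero    zero    i≢j = contradiction refl i≢j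
      touching′ zero    (suc j) _   =
        let d , x , d~x , dd , lx = touches j in
        d , x , d~x ,
        from (adjoin-zero D? label) dd , from (adjoin-suc D? label fresh) lx
      touching′ (suc i) zero    _   =
        let d , x , d~x , dd , lx = touches i in
        x , d , ~-sym d~x ,
        from (adjoin-suc D? label fresh) lx , from (adjoin-zero D? label) dd
      touching′ (suc i) (suc j) i≢j =
        let x , y , x~y , lx , ly = touching (i≢j ∘ cong suc) in
        x , y , x~y ,
        from (adjoin-suc D? label fresh) lx , from (adjoin-suc D? label fresh) ly

  -- Maximal packings and the component of a vertex in `V`.

  module _ (V : Subset n) where

    Covered : Subset n → U.Pred (Fin n) 0ℓ
    Covered S x = x ∈ V × ∃ λ s → s ∈ S × Nb x s

    Covered? : ∀ S → U.Decidable (Covered S)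
    Covered? S x = (x ∈? V) ×-dec any? λ s → (s ∈? S) ×-dec Nb? x s

    -- May overlap `Covered S` and leave `V`; `Reached?` and `Remaining?` make the restrictions.
    Fringe : Subset n → U.Pred (Fin n) 0ℓ
    Fringe S x = ∃ λ d → Covered S d × d ~ x

    Fringe? : ∀ S → U.Decidable (Fringe S)
    Fringe? S x = any? λ d → Covered? S d ×-dec (d ~? x)

    -- By `far`, distinct members of `S` have distance at least three within `V`, so a covered
    -- vertex sees exactly one of them. By `path`, the covered set is connected and can serve as a
    -- branch set.
    record Packing (r : Fin n) (S : Subset n) : Set where
      field
        S⊆V  : S ⊆ V
        root : r ∈ S
        far  : ∀ {x s t} → x ∈ V → s ∈ S → t ∈ S → Nb x s → Nb x t → s ≡ t
        path : ∀ {x} → Covered S x → Path G (Covered S) x r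

    -- A vertex at distance exactly three from S, which can be added to S.
    Addable : Subset n → U.Pred (Fin n) 0ℓ
    Addable S v = v ∈ V × ¬ Covered S v × ¬ Fringe S v ×
                  ∃ λ l → l ∈ V × l ~ v × Fringe S l

    Addable? : ∀ S → U.Decidable (Addable S)
    Addable? S v =
      (v ∈? V) ×-dec ¬? (Covered? S v) ×-dec ¬? (Fringe? S v) ×-dec
      any? λ l → (l ∈? V) ×-dec (l ~? v) ×-dec Fringe? S l

    -- As `v` is neither covered nor adjacent to a covered vertex, nothing covered by `S` sees `v`.
    -- The vertex `l`, now covered by `v`, links `v` to the old covered set through `d`.
    add : ∀ {r S v} → Packing r S → Addable S v → Packing r (S ∪ ⁅ v ⁆)
    add {r} {S} {v} packing (v∈V , ¬cv , ¬fv , l , l∈V , l~v , d , cd , d~l) = record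
      { S⊆V  = λ s∈ → Sum.[ S⊆V , (λ { refl → v∈V }) ]′ (∈⁻ s∈)
      ; root = S⊆S′ root
      ; far  = λ x∈V s∈ t∈ → far′ x∈V (∈⁻ s∈) (∈⁻ t∈)
      ; path = path′
      }
      where
      open Packing packing
      S′ = S ∪ ⁅ v ⁆

      ∈⁻ : ∀ {x} → x ∈ S′ → x ∈ S ⊎ x ≡ v
      ∈⁻ = Sum.map₂ (x∈⁅y⁆⇒x≡y v) ∘ x∈p∪q⁻ S ⁅ v ⁆

      S⊆S′ : S ⊆ S′
      S⊆S′ = p⊆p∪q ⁅ v ⁆

      v∈S′ : v ∈ S′
      v∈S′ = q⊆p∪q S ⁅ v ⁆ (x∈⁅x⁆ v)

      mono : ∀ {x} → Covered S x → Covered S′ x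
      mono (x∈V , s , s∈S , nb) = x∈V , s , S⊆S′ s∈S , nb

      apart : ∀ {x} → Covered S x → ¬ Nb x v
      apart cx (inj₁ refl) = ¬cv cx
      apart cx (inj₂ x~v)  = ¬fv (_ , cx , x~v)

      far′ : ∀ {x s t} → x ∈ V → s ∈ S ⊎ s ≡ v → t ∈ S ⊎ t ≡ v →
             Nb x s → Nb x t → s ≡ t
      far′ x∈V (inj₁ s∈S)  (inj₁ t∈S)  nbs nbt = far x∈V s∈S t∈S nbs nbt
      far′ x∈V (inj₁ s∈S)  (inj₂ refl) nbs nbt =
        contradiction nbt (apart (x∈V , _ , s∈S , nbs))
      far′ x∈V (inj₂ refl) (inj₁ t∈S)  nbs nbt =
        contradiction nbs (apart (x∈V , _ , t∈S , nbt))
      far′ x∈V (inj₂ refl) (inj₂ refl) nbs nbt = refl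

      path-v : Path G (Covered S′) v r
      path-v =
        (~-sym l~v , (v∈V , v , v∈S′ , inj₁ refl) , cl) ◅
        (~-sym d~l , cl , mono cd) ◅
        Path-mono mono (path cd)
        where cl = l∈V , v , v∈S′ , inj₂ l~v

      path′ : ∀ {x} → Covered S′ x → Path G (Covered S′) x r
      path′ (x∈V , s , s∈S′ , nb) with ∈⁻ s∈S′
      path′ (x∈V , s , s∈S′ , nb)         | inj₁ s∈S  =
        Path-mono mono (path (x∈V , s , s∈S , nb))
      path′ (x∈V , s , s∈S′ , inj₁ refl)  | inj₂ refl = path-v
      path′ (x∈V , s , s∈S′ , inj₂ x~v)   | inj₂ refl =
        (x~v , (x∈V , v , s∈S′ , inj₂ x~v) , (v∈V , v , s∈S′ , inj₁ refl)) ◅ path-v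

    saturate : ∀ {r S} → Packing r S → Acc _⊃_ S →
               ∃ λ S′ → Packing r S′ × ¬ ∃ (Addable S′)
    saturate {S = S} packing (acc larger) with any? (Addable? S)
    ... | no  ¬addable = S , packing , ¬addable
    ... | yes (v , addable@(v∈V , ¬cv , _)) =
      saturate (add packing addable) (larger
        (p⊆p∪q ⁅ v ⁆ , v , q⊆p∪q S ⁅ v ⁆ (x∈⁅x⁆ v) ,
         λ v∈S → ¬cv (v∈V , v , v∈S , inj₁ refl)))

    initial : ∀ {r} → r ∈ V → Packing r ⁅ r ⁆
    initial {r} r∈V = record
      { S⊆V  = λ x∈ → subst (_∈ V) (sym (x∈⁅y⁆⇒x≡y r x∈)) r∈V
      ; root = x∈⁅x⁆ r
      ; far  = λ _ s∈ t∈ _ _ → trans (x∈⁅y⁆⇒x≡y r s∈) (sym (x∈⁅y⁆⇒x≡y r t∈))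
      ; path = λ (x∈V , s , s∈ , nb) → path x∈V (x∈⁅y⁆⇒x≡y r s∈) nb
      }
      where
      path : ∀ {x s} → x ∈ V → s ≡ r → Nb x s → Path G (Covered ⁅ r ⁆) x r
      path x∈V refl (inj₁ refl) = ε
      path x∈V refl (inj₂ x~r)  =
        (x~r , (x∈V , r , x∈⁅x⁆ r , inj₂ x~r) , (r∈V , r , x∈⁅x⁆ r , inj₁ refl)) ◅ ε

    Reached? : ∀ S → U.Decidable (λ x → x ∈ V × (Covered S x ⊎ Fringe S x))
    Reached? S x = (x ∈? V) ×-dec (Covered? S x ⊎-dec Fringe? S x)

    Remaining? : ∀ S → U.Decidable (λ x → x ∈ V × ¬ Covered S x × Fringe S x)
    Remaining? S x = (x ∈? V) ×-dec ¬? (Covered? S x) ×-dec Fringe? S x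

    -- `C` is the component of `r` in the graph induced on `V`: connected by `C-path` and closed
    -- under adjacency by `closed`. `L` is what remains of it outside the covered set.
    record Decomposition (r : Fin n) : Set where
      field
        S       : Subset n
        packing : Packing r S
        maximal : ¬ ∃ (Addable S)
      open Packing packing public

      C L : Subset n
      C = ⟦ Reached? S ⟧
      L = ⟦ Remaining? S ⟧

      C⊆V : C ⊆ V
      C⊆V = proj₁ ∘ to (∈⟦⟧ (Reached? S))

      ∈L : ∀ {x} → x ∈ L ⇔ (x ∈ V × ¬ Covered S x × Fringe S x)
      ∈L = ∈⟦⟧ (Remaining? S)

      Covered⇒∈C : ∀ {x} → Covered S x → x ∈ C
      Covered⇒∈C cx = from (∈⟦⟧ (Reached? S)) (proj₁ cx , inj₁ cx)

      r∈C : r ∈ C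
      r∈C = Covered⇒∈C (S⊆V root , r , root , inj₁ refl)

      S⊆C : S ⊆ C
      S⊆C s∈S = Covered⇒∈C (S⊆V s∈S , _ , s∈S , inj₁ refl)

      L⊆C : L ⊆ C
      L⊆C x∈L = let x∈V , _ , fx = to ∈L x∈L in
        from (∈⟦⟧ (Reached? S)) (x∈V , inj₂ fx)

      C⇒Covered⊎L : ∀ {x} → x ∈ C → Covered S x ⊎ x ∈ L
      C⇒Covered⊎L {x} x∈C with Covered? S x | to (∈⟦⟧ (Reached? S)) x∈C
      ... | yes cx | _              = inj₁ cx
      ... | no ¬cx | _   , inj₁ cx  = contradiction cx ¬cx
      ... | no ¬cx | x∈V , inj₂ fx  = inj₂ (from ∈L (x∈V , ¬cx , fx))

      -- A neighbour of a covered vertex is on the fringe. An unreached neighbour of a fringe vertex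
      -- `x` would be addable, with `x` as the witness, against maximality.
      closed : ∀ {x y} → x ∈ C → y ∈ V → x ~ y → y ∈ C
      closed {x} {y} x∈C y∈V x~y with Reached? S y | to (∈⟦⟧ (Reached? S)) x∈C
      ... | yes reached | _ = from (∈⟦⟧ (Reached? S)) reached
      ... | no ¬reached | x∈V , inj₁ cx =
        contradiction (y∈V , inj₂ (x , cx , x~y)) ¬reached
      ... | no ¬reached | x∈V , inj₂ fx = contradiction
        (y , y∈V , (λ cy → ¬reached (y∈V , inj₁ cy)) ,
         (λ fy → ¬reached (y∈V , inj₂ fy)) , x , x∈V , x~y , fx)
        maximal

      C-path : ∀ {x} → x ∈ C → Path G (_∈ C) x r
      C-path x∈C with to (∈⟦⟧ (Reached? S)) x∈C
      ... | _ , inj₁ cx             = Path-mono Covered⇒∈C (path cx)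
      ... | _ , inj₂ (d , cd , d~x) =
        (~-sym d~x , x∈C , Covered⇒∈C cd) ◅ Path-mono Covered⇒∈C (path cd)

    decompose : ∀ {r} → r ∈ V → Decomposition r
    decompose r∈V with saturate (initial r∈V) (⊃-wellFounded _)
    ... | S , packing , maximal = record
      { S = S ; packing = packing ; maximal = maximal }

  -- Selections on vertex sets: gluing components and adding a colour.

  -- The selector's set is the domain of the partial map `colour`. Relativizing to `V` keeps one
  -- ambient graph throughout the induction.
  record Selection (k : ℕ) (V : Subset n) : Set where
    field
      colour      : Fin n → Maybe (Fin k)
      within      : ∀ {x i} → colour x ≡ just i → x ∈ V
      independent : ∀ {x y i j} → colour x ≡ just i → colour y ≡ just j → ¬ x ~ y
      selects     : ∀ {x} → x ∈ V →
                    ∃ λ i → Parity true (λ y → Nb x y × colour y ≡ just i)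

  empty-selection : ∀ {k V} → (∀ {x} → x ∉ V) → Selection k V
  empty-selection ∉V = record
    { colour      = λ _ → nothing
    ; within      = λ ()
    ; independent = λ ()
    ; selects     = λ x∈V → contradiction x∈V ∉V
    }

  -- Closed neighbourhoods make this include disjointness.
  Separated : Subset n → Subset n → Set
  Separated V W = ∀ {x y} → x ∈ V → y ∈ W → ¬ Nb x y

  Nb-sym : ∀ {x y} → Nb x y → Nb y x
  Nb-sym = Sum.map sym ~-sym

  ─-separated : ∀ {V C} → (∀ {x y} → x ∈ C → y ∈ V → x ~ y → y ∈ C) →
                Separated C (V ─ C)
  ─-separated {V} {C} closed x∈C y∈ (inj₁ refl) = x∈p─q⇒x∉q V C y∈ x∈C
  ─-separated {V} {C} closed x∈C y∈ (inj₂ x~y)  =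
    x∈p─q⇒x∉q V C y∈ (closed x∈C (p─q⊆p V C y∈) x~y)

  ─-cover : ∀ {V C : Subset n} {x} → x ∈ V → x ∈ C ⊎ x ∈ V ─ C
  ─-cover {C = C} {x} x∈V with x ∈? C
  ... | yes x∈C = inj₁ x∈C
  ... | no  x∉C = inj₂ (x∈p∧x∉q⇒x∈p─q x∈V x∉C)

  glue : ∀ {k V C R} → C ⊆ V → R ⊆ V → (∀ {x} → x ∈ V → x ∈ C ⊎ x ∈ R) →
         Separated C R → Selection k C → Selection k R → Selection k V
  glue {k} {V} {C} {R} C⊆V R⊆V cover separated σC σR = record
    { colour      = colour
    ; within      = Sum.[ C⊆V ∘ C.within , R⊆V ∘ R.within ]′ ∘ colour⁻
    ; independent = λ cx cy → independent (colour⁻ cx) (colour⁻ cy)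
    ; selects     = Sum.[ selects-C , selects-R ]′ ∘ cover
    }
    where
    module C = Selection σC
    module R = Selection σR

    colour : Fin n → Maybe (Fin k)
    colour x with x ∈? C
    ... | yes _ = C.colour x
    ... | no  _ = R.colour x

    colour⁻ : ∀ {x i} → colour x ≡ just i → C.colour x ≡ just i ⊎ R.colour x ≡ just i
    colour⁻ {x} eq with x ∈? C
    ... | yes _ = inj₁ eq
    ... | no  _ = inj₂ eq

    colour-C : ∀ {x i} → C.colour x ≡ just i → colour x ≡ just i
    colour-C {x} eq with x ∈? C
    ... | yes _   = eq
    ... | no  x∉C = contradiction (C.within eq) x∉C

    colour-R : ∀ {x i} → R.colour x ≡ just i → colour x ≡ just i
    colour-R {x} eq with x ∈? C
    ... | yes x∈C = contradiction (inj₁ refl) (separated x∈C (R.within eq))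
    ... | no  _   = eq

    independent : ∀ {x y i j} →
      C.colour x ≡ just i ⊎ R.colour x ≡ just i →
      C.colour y ≡ just j ⊎ R.colour y ≡ just j → ¬ x ~ y
    independent (inj₁ cx) (inj₁ cy) = C.independent cx cy
    independent (inj₁ cx) (inj₂ ry) = separated (C.within cx) (R.within ry) ∘ inj₂
    independent (inj₂ rx) (inj₁ cy) =
      separated (C.within cy) (R.within rx) ∘ inj₂ ∘ ~-sym
    independent (inj₂ rx) (inj₂ ry) = R.independent rx ry

    selects-C : ∀ {x} → x ∈ C →
                ∃ λ i → Parity true (λ y → Nb x y × colour y ≡ just i)
    selects-C {x} x∈C with C.selects x∈C
    ... | i , odd = i , Parity-cong
      (mk⇔ (λ (nb , cy) → nb , colour-C cy)
           (λ (nb , cy) → nb , Sum.[ id , (λ ry → contradiction nb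
                                      (separated x∈C (R.within ry))) ]′ (colour⁻ cy)))
      odd

    selects-R : ∀ {x} → x ∈ R →
                ∃ λ i → Parity true (λ y → Nb x y × colour y ≡ just i)
    selects-R {x} x∈R with R.selects x∈R
    ... | i , odd = i , Parity-cong
      (mk⇔ (λ (nb , cy) → nb , colour-R cy)
           (λ (nb , cy) → nb , Sum.[ (λ cy → contradiction (Nb-sym nb)
                                      (separated (C.within cy) x∈R)) , id ]′ (colour⁻ cy)))
      odd

  -- The new colour `zero` is used on `S`, and a covered vertex sees it exactly once. Vertices of
  -- `L` keep their old colour. No edge joins `S` to `L`, since neighbours of `S` in `V` are
  -- covered.
  add-colour : ∀ {k V r} (Δ : Decomposition V r) → let open Decomposition Δ in
               Selection k L → Selection (suc k) C
  add-colour {k} {V} Δ σ = record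
    { colour      = colour
    ; within      = λ {x} {i} → within′ {x} i
    ; independent = λ {x} {y} {i} {j} → independent′ {x} {y} i j
    ; selects     = Sum.[ selects-covered , selects-L ]′ ∘ C⇒Covered⊎L
    }
    where
    open Decomposition Δ
    module L = Selection σ

    colour : Fin n → Maybe (Fin (suc k))
    colour = adjoin (_∈? S) L.colour

    S-covered : ∀ {s} → s ∈ S → Covered V S s
    S-covered s∈S = S⊆V s∈S , _ , s∈S , inj₁ refl

    colour-S : ∀ {x} → colour x ≡ just zero ⇔ x ∈ S
    colour-S = adjoin-zero (_∈? S) L.colour

    colour-L : ∀ {x i} → colour x ≡ just (suc i) ⇔ L.colour x ≡ just i
    colour-L = adjoin-suc (_∈? S) L.colour λ eq x∈S →
      proj₁ (proj₂ (to ∈L (L.within eq))) (S-covered x∈S)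

    within′ : ∀ {x} i → colour x ≡ just i → x ∈ C
    within′ zero    eq = S⊆C (to colour-S eq)
    within′ (suc i) eq = L⊆C (L.within (to colour-L eq))

    S≁L : ∀ {s x} → s ∈ S → x ∈ L → ¬ s ~ x
    S≁L s∈S x∈L s~x = let x∈V , ¬cx , _ = to ∈L x∈L in
      ¬cx (x∈V , _ , s∈S , inj₂ (~-sym s~x))

    independent′ : ∀ {x y} i j → colour x ≡ just i → colour y ≡ just j → ¬ x ~ y
    independent′ zero zero cx cy x~y =
      -- Adjacent `x` and `y` both lie in the closed neighbourhood of `x`, so `far` would make them
      -- equal.
      ~-irrefl (far (S⊆V x∈S) x∈S (to colour-S cy) (inj₁ refl) (inj₂ x~y)) x~y
      where x∈S = to colour-S cx
    independent′ zero (suc j) cx cy =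
      S≁L (to colour-S cx) (L.within (to colour-L cy))
    independent′ (suc i) zero cx cy =
      S≁L (to colour-S cy) (L.within (to colour-L cx)) ∘ ~-sym
    independent′ (suc i) (suc j) cx cy =
      L.independent (to colour-L cx) (to colour-L cy)

    selects-covered : ∀ {x} → Covered V S x →
      ∃ λ i → Parity true (λ y → Nb x y × colour y ≡ just i)
    selects-covered (x∈V , s , s∈S , nb) = zero , Parity-singleton
      (nb , from colour-S s∈S)
      (λ (nb′ , cy) → far x∈V (to colour-S cy) s∈S nb′ nb)

    selects-L : ∀ {x} → x ∈ L →
      ∃ λ i → Parity true (λ y → Nb x y × colour y ≡ just i)
    selects-L x∈L with L.selects x∈L
    ... | i , odd = suc i , Parity-cong
      (mk⇔ (λ (nb , cy) → nb , from colour-L cy)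
           (λ (nb , cy) → nb , to colour-L cy))
      odd

  -- The covered set is the new branch set; it touches every old one because each vertex of `L` has
  -- a covered neighbour.
  extend-L-model : ∀ {m V r} (Δ : Decomposition V r) → let open Decomposition Δ in
                   Model G m (_∈ L) → Model G (suc m) (_∈ V)
  extend-L-model {V = V} Δ M = extend-model M (Covered? V S)
    (_ , (S⊆V root , _ , root , inj₁ refl) , path)
    (λ cx x∈L → proj₁ (proj₂ (to ∈L x∈L)) cx)
    proj₁
    (proj₁ ∘ to ∈L)
    (λ i → let x , lx , _ = Model.connected M i
               d , cd , d~x = proj₂ (proj₂ (to ∈L (Model.within M lx)))
           in d , x , d~x , cd , lx)
    where open Decomposition Δ

-- One colour: states of rooted forests and their joins.

-- What an independent set S of a rooted forest, with every vertex other than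
-- the root satisfied, does at the root r: r ∈ S, or r ∉ S sees an odd or an
-- even number of vertices of S.
data State : Set where
  root-in root-odd root-even : State

-- Also the parity of `S` in the closed neighbourhood of the root: by independence a root in `S`
-- sees only itself.
satisfied : State → Bool
satisfied root-in   = true
satisfied root-odd  = true
satisfied root-even = false

chosen : State → Bool
chosen root-in   = true
chosen root-odd  = false
chosen root-even = false

-- Join s t u: joining by an edge the roots of two forests, in states s and t,
-- satisfies the second root and puts the first one in state u.
data Join : State → State → State → Set where
  in-even  : Join root-in   root-even root-in
  odd-odd  : Join root-odd  root-odd  root-odd
  even-in  : Join root-even root-in   root-odd
  even-odd : Join root-even root-odd  root-even
  odd-in   : Join root-odd  root-in   root-even

module _ {s t u : State} where

  -- The joining edge lets each root see the other, so its parity changes by the `chosen` bit of the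
  -- other.
  Join-satisfied : Join s t u → satisfied s xor chosen t ≡ satisfied u
  Join-satisfied in-even  = refl
  Join-satisfied odd-odd  = refl
  Join-satisfied even-in  = refl
  Join-satisfied even-odd = refl
  Join-satisfied odd-in   = refl

  Join-satisfies : Join s t u → chosen s xor satisfied t ≡ true
  Join-satisfies in-even  = refl
  Join-satisfies odd-odd  = refl
  Join-satisfies even-in  = refl
  Join-satisfies even-odd = refl
  Join-satisfies odd-in   = refl

  Join-chosen : Join s t u → chosen s ≡ chosen u
  Join-chosen in-even  = refl
  Join-chosen odd-odd  = refl
  Join-chosen even-in  = refl
  Join-chosen even-odd = refl
  Join-chosen odd-in   = refl

  Join-independent : Join s t u → chosen s ≡ true → chosen t ≢ true
  Join-independent in-even _ ()

data TwoStates (P : State → Set) : Set where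
  in,odd   : P root-in  → P root-odd  → TwoStates P
  in,even  : P root-in  → P root-even → TwoStates P
  odd,even : P root-odd → P root-even → TwoStates P

-- One state on each side would not suffice: two forests in state `root-in` have no join. Two on
-- each side always allow two joins with different results.
join-states : {P Q R : State → Set} →
  (∀ {s t u} → Join s t u → P s → Q t → R u) →
  TwoStates P → TwoStates Q → TwoStates R
join-states j (in,odd   _ o) (in,odd   i′ o′) = odd,even (j odd-odd o o′) (j odd-in o i′)
join-states j (in,even  _ e) (in,odd   i′ o′) = odd,even (j even-in e i′) (j even-odd e o′)
join-states j (odd,even _ e) (in,odd   i′ o′) = odd,even (j even-in e i′) (j even-odd e o′)
join-states j (in,odd   i o) (in,even  i′ e′) = in,even (j in-even i e′) (j odd-in o i′)
join-states j (in,even  i e) (in,even  i′ e′) = in,odd (j in-even i e′) (j even-in e i′)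
join-states j (odd,even o e) (in,even  i′ _)  = odd,even (j even-in e i′) (j odd-in o i′)
join-states j (in,odd   i o) (odd,even o′ e′) = in,odd (j in-even i e′) (j odd-odd o o′)
join-states j (in,even  i e) (odd,even o′ e′) = in,even (j in-even i e′) (j even-odd e o′)
join-states j (odd,even o e) (odd,even o′ _)  = odd,even (j odd-odd o o′) (j even-odd e o′)

-- Rooted solutions in a graph.

module _ (G : Graph n) where
  open Graph G

  record Rooted (V : Subset n) (r : Fin n) (s : State) : Set where
    field
      S           : Subset n
      S⊆V         : S ⊆ V
      independent : Independent G S
      root∈S      : r ∈ S ⇔ chosen s ≡ true
      root-parity : Parity (satisfied s) (λ y → Nb G r y × y ∈ S)
      odd         : ∀ {x} → x ∈ V → x ≢ r → Parity true (λ y → Nb G x y × y ∈ S)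

    root-contribution : Parity (chosen s) (λ y → y ≡ r × y ∈ S)
    root-contribution with chosen s in eq
    ... | true  = Parity-singleton (refl , from root∈S eq) proj₁
    ... | false = Parity-empty λ { (refl , r∈S) →
                    contradiction (trans (sym eq) (to root∈S r∈S)) λ () }

  -- The edge from `r` to `w` is the only one between `V` and `W`, so the union of the two sets
  -- changes the counts at `r` and `w` alone, and the join table controls both.
  merge : ∀ {U V W r w s t u} →
    V ⊆ U → W ⊆ U → (∀ {x} → x ∈ U → x ∈ V ⊎ x ∈ W) →
    (∀ {x} → x ∈ V → x ∉ W) → r ∈ V → w ∈ W → r ~ w →
    (∀ {x y} → x ∈ V → y ∈ W → x ~ y → x ≡ r × y ≡ w) →
    Join s t u → Rooted V r s → Rooted W w t → Rooted U r u
  merge {U} {V} {W} {r} {w} V⊆U W⊆U cover disjoint r∈V w∈W r~w only j ρ ω = record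
    { S           = S
    ; S⊆V         = Sum.[ V⊆U ∘ V.S⊆V , W⊆U ∘ W.S⊆V ]′ ∘ ∈⁻
    ; independent = λ x∈ y∈ → independent′ (∈⁻ x∈) (∈⁻ y∈)
    ; root∈S      = mk⇔
        (λ r∈S → trans (sym (Join-chosen j))
          (to V.root∈S (Sum.[ id , (λ r∈W → contradiction (W.S⊆V r∈W) (disjoint r∈V)) ]′
                         (∈⁻ r∈S))))
        (λ eq → ∈⁺ (inj₁ (from V.root∈S (trans (Join-chosen j) eq))))
    ; root-parity = Parity-≡ (Join-satisfied j)
        (combine V.root-parity (at-r W.root-contribution))
    ; odd         = λ x∈U x≢r → Sum.[ odd-V x≢r , odd-W ]′ (cover x∈U)
    }
    where
    module V = Rooted ρ
    module W = Rooted ω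

    S : Subset n
    S = V.S ∪ W.S

    ∈⁻ : ∀ {x} → x ∈ S → x ∈ V.S ⊎ x ∈ W.S
    ∈⁻ = x∈p∪q⁻ V.S W.S

    ∈⁺ : ∀ {x} → x ∈ V.S ⊎ x ∈ W.S → x ∈ S
    ∈⁺ = x∈p∪q⁺

    crossing : ∀ {x y} → x ∈ V.S → y ∈ W.S → ¬ x ~ y
    crossing x∈ y∈ x~y with only (V.S⊆V x∈) (W.S⊆V y∈) x~y
    ... | refl , refl =
      Join-independent j (to V.root∈S x∈) (to W.root∈S y∈)

    independent′ : ∀ {x y} → x ∈ V.S ⊎ x ∈ W.S → y ∈ V.S ⊎ y ∈ W.S → ¬ x ~ y
    independent′ (inj₁ x∈) (inj₁ y∈) = V.independent x∈ y∈
    independent′ (inj₁ x∈) (inj₂ y∈) = crossing x∈ y∈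
    independent′ (inj₂ x∈) (inj₁ y∈) = crossing y∈ x∈ ∘ ~-sym
    independent′ (inj₂ x∈) (inj₂ y∈) = W.independent x∈ y∈

    combine : ∀ {x a b} →
      Parity a (λ y → Nb G x y × y ∈ V.S) → Parity b (λ y → Nb G x y × y ∈ W.S) →
      Parity (a xor b) (λ y → Nb G x y × y ∈ S)
    combine p q = Parity-cong
      (mk⇔ Sum.[ (λ (nb , y∈) → nb , ∈⁺ (inj₁ y∈)) , (λ (nb , y∈) → nb , ∈⁺ (inj₂ y∈)) ]′
           (λ (nb , y∈) → Sum.map (nb ,_) (nb ,_) (∈⁻ y∈)))
      (Parity-⊎ (λ (_ , y∈V) (_ , y∈W) → disjoint (V.S⊆V y∈V) (W.S⊆V y∈W)) p q)

    seen-from-V : ∀ {x y} → x ∈ V → y ∈ W.S → Nb G x y → x ≡ r × y ≡ w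
    seen-from-V x∈V y∈ (inj₁ refl) = contradiction (W.S⊆V y∈) (disjoint x∈V)
    seen-from-V x∈V y∈ (inj₂ x~y)  = only x∈V (W.S⊆V y∈) x~y

    seen-from-W : ∀ {x y} → x ∈ W → y ∈ V.S → Nb G x y → y ≡ r × x ≡ w
    seen-from-W x∈W y∈ (inj₁ refl) = contradiction x∈W (disjoint (V.S⊆V y∈))
    seen-from-W x∈W y∈ (inj₂ x~y)  = only (V.S⊆V y∈) x∈W (~-sym x~y)

    at-r : ∀ {b} → Parity b (λ y → y ≡ w × y ∈ W.S) →
           Parity b (λ y → Nb G r y × y ∈ W.S)
    at-r = Parity-cong (mk⇔ (λ { (refl , w∈) → inj₂ r~w , w∈ })
                            (λ (nb , y∈) → proj₂ (seen-from-V r∈V y∈ nb) , y∈))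

    at-w : ∀ {b} → Parity b (λ y → y ≡ r × y ∈ V.S) →
           Parity b (λ y → Nb G w y × y ∈ V.S)
    at-w = Parity-cong (mk⇔ (λ { (refl , r∈) → inj₂ (~-sym r~w) , r∈ })
                            (λ (nb , y∈) → proj₁ (seen-from-W w∈W y∈ nb) , y∈))

    odd-V : ∀ {x} → x ≢ r → x ∈ V → Parity true (λ y → Nb G x y × y ∈ S)
    odd-V x≢r x∈V = combine (V.odd x∈V x≢r)
      (Parity-empty λ (nb , y∈) → x≢r (proj₁ (seen-from-V x∈V y∈ nb)))

    odd-W : ∀ {x} → x ∈ W → Parity true (λ y → Nb G x y × y ∈ S)
    odd-W {x} x∈W with x ≟ w
    ... | yes refl = Parity-≡ (Join-satisfies j)
                       (combine (at-w V.root-contribution) W.root-parity)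
    ... | no  x≢w  = combine
      (Parity-empty λ (nb , y∈) → x≢w (proj₂ (seen-from-W x∈W y∈ nb)))
      (W.odd x∈W x≢w)

  record OddSet (V : Subset n) : Set where
    field
      S           : Subset n
      S⊆V         : S ⊆ V
      independent : Independent G S
      odd         : ∀ {x} → x ∈ V → Parity true (λ y → Nb G x y × y ∈ S)

  rooted⇒oddSet : ∀ {V r s} → satisfied s ≡ true → Rooted V r s → OddSet V
  rooted⇒oddSet {r = r} eq ρ = record
    { S = S ; S⊆V = S⊆V ; independent = independent
    ; odd = λ {x} x∈V → odd′ x∈V (x ≟ r)
    }
    where
    open Rooted ρ
    odd′ : ∀ {x} → x ∈ _ → Dec (x ≡ r) → Parity true (λ y → Nb G x y × y ∈ S)
    odd′ x∈V (yes refl) = Parity-≡ eq root-parity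
    odd′ x∈V (no  x≢r)  = odd x∈V x≢r

  two-states⇒oddSet : ∀ {V r} → TwoStates (Rooted V r) → OddSet V
  two-states⇒oddSet (in,odd   i _) = rooted⇒oddSet refl i
  two-states⇒oddSet (in,even  i _) = rooted⇒oddSet refl i
  two-states⇒oddSet (odd,even o _) = rooted⇒oddSet refl o

  -- A solution on `V - r` may be taken with or without `r`: no other vertex notices, and `r` sees
  -- one or no chosen vertex.
  isolated-root : ∀ {V r} → r ∈ V → (∀ {x} → x ∈ V → ¬ r ~ x) →
                  OddSet (V - r) → TwoStates (Rooted V r)
  isolated-root {V} {r} r∈V isolated σ = in,even
    record
      { S           = S ∪ ⁅ r ⁆
      ; S⊆V         = Sum.[ S⊆V , (λ { refl → r∈V }) ]′ ∘ ∈⁻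
      ; independent = λ x∈ y∈ → independent′ (∈⁻ x∈) (∈⁻ y∈)
      ; root∈S      = mk⇔ (λ _ → refl) (λ _ → q⊆p∪q S ⁅ r ⁆ (x∈⁅x⁆ r))
      ; root-parity = Parity-singleton (inj₁ refl , q⊆p∪q S ⁅ r ⁆ (x∈⁅x⁆ r))
          (λ (nb , y∈) → Sum.[ (λ y∈S → contradiction nb (r-blind y∈S)) , id ]′ (∈⁻ y∈))
      ; odd         = λ x∈V x≢r → Parity-cong
          (mk⇔ (λ (nb , y∈) → nb , p⊆p∪q ⁅ r ⁆ y∈)
               (λ (nb , y∈) → nb , Sum.[ id , (λ { refl → contradiction nb
                                                 (r-unseen x∈V x≢r) }) ]′ (∈⁻ y∈)))
          (odd (x∈p∧x≢y⇒x∈p-y x∈V x≢r))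
      }
    record
      { S           = S
      ; S⊆V         = S⊆V
      ; independent = independent
      ; root∈S      = mk⇔ (λ r∈S → contradiction refl (proj₂ (x∈p-y⁻ V (OddSet.S⊆V σ r∈S))))
                          (λ ())
      ; root-parity = Parity-empty λ (nb , y∈S) → r-blind y∈S nb
      ; odd         = λ x∈V x≢r → odd (x∈p∧x≢y⇒x∈p-y x∈V x≢r)
      }
    where
    open OddSet σ hiding (S⊆V)

    S⊆V : S ⊆ V
    S⊆V = proj₁ ∘ x∈p-y⁻ V ∘ OddSet.S⊆V σ

    ∈⁻ : ∀ {x} → x ∈ S ∪ ⁅ r ⁆ → x ∈ S ⊎ x ≡ r
    ∈⁻ = Sum.map₂ (x∈⁅y⁆⇒x≡y r) ∘ x∈p∪q⁻ S ⁅ r ⁆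

    r-blind : ∀ {y} → y ∈ S → ¬ Nb G r y
    r-blind y∈S (inj₁ y≡r) = proj₂ (x∈p-y⁻ V (OddSet.S⊆V σ y∈S)) y≡r
    r-blind y∈S (inj₂ r~y) = isolated (S⊆V y∈S) r~y

    r-unseen : ∀ {x} → x ∈ V → x ≢ r → ¬ Nb G x r
    r-unseen x∈V x≢r (inj₁ r≡x) = x≢r (sym r≡x)
    r-unseen x∈V x≢r (inj₂ x~r) = isolated x∈V (~-sym x~r)

    independent′ : ∀ {x y} → x ∈ S ⊎ x ≡ r → y ∈ S ⊎ y ≡ r → ¬ x ~ y
    independent′ (inj₁ x∈)   (inj₁ y∈)   = independent x∈ y∈
    independent′ (inj₁ x∈)   (inj₂ refl) = isolated (S⊆V x∈) ∘ ~-sym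
    independent′ (inj₂ refl) (inj₁ y∈)   = isolated (S⊆V y∈)
    independent′ (inj₂ refl) (inj₂ refl) = ~-irrefl refl

  -- Forests: cutting at an edge of the root.

  -- If w and x were distinct, then r, w and the component of x in W - w would
  -- be the branch sets of a triangle.
  unique-attachment : ∀ {V W r w x} → ¬ Model G 3 (_∈ V) → W ⊆ V - r → r ∈ V →
    (∀ {y} → y ∈ W → Path G (_∈ W) y w) → w ∈ W → x ∈ W → r ~ w → r ~ x → x ≡ w
  unique-attachment {V} {W} {r} {w} {x} no-triangle W⊆ r∈V path w∈W x∈W r~w r~x
    with x ≟ w
  ... | yes x≡w = x≡w
  ... | no  x≢w = contradiction
    (extend-model G edge (_≟ r) (Connected-singleton G)
      (λ { refl r∈W → proj₂ (x∈p-y⁻ V (W⊆ r∈W)) refl })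
      (λ { refl → r∈V }) (proj₁ ∘ x∈p-y⁻ V ∘ W⊆)
      -- In `edge` the label `zero` belongs to `w` and `suc zero` to the component of `x`.
      λ { zero → r , w , r~w , refl , from (adjoin-zero (_≟ w) _) refl
        ; (suc zero) →
            r , x , r~x , refl ,
            from (adjoin-suc (_≟ w) _ (λ {y} → ≢w {y}) {x}) x-labelled })
    no-triangle
    where
    Δ = decompose G (W - w) (x∈p∧x≢y⇒x∈p-y x∈W x≢w)
    open Decomposition Δ using (C; C⊆V; C-path; closed; r∈C)

    C⊆W : C ⊆ W
    C⊆W = proj₁ ∘ x∈p-y⁻ W ∘ C⊆V

    w∉C : w ∉ C
    w∉C w∈C = proj₂ (x∈p-y⁻ W (C⊆V w∈C)) refl

    C-neighbour : ∃ λ c → c ∈ C × w ~ c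
    -- The path from `x` to `w` must leave `C`; as `C` is closed in `W - w`, it can do so only into
    -- `w`.
    C-neighbour with exit-edge G (_∈? C) (path x∈W) r∈C w∉C
    ... | c , d , c~d , d∈W , c∈C , d∉C with d ≟ w
    ...   | yes refl = c , c∈C , ~-sym c~d
    ...   | no  d≢w  =
      contradiction (closed c∈C (x∈p∧x≢y⇒x∈p-y d∈W d≢w) c~d) d∉C

    component : Model G 1 (_∈ C)
    component = extend-model G (empty-model G {P = λ _ → Empty.⊥}) (_∈? C)
      (x , r∈C , C-path) (λ _ ()) id (λ ()) (λ ())

    x-labelled : Model.label component x ≡ just zero
    x-labelled = from (adjoin-zero (_∈? C) (λ _ → nothing)) r∈C

    ≢w : ∀ {y i} → Model.label component y ≡ just i → y ≢ w
    ≢w {y} ly refl = w∉C (Model.within component {y} ly)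

    edge : Model G 2 (_∈ W)
    edge = extend-model G component (_≟ w) (Connected-singleton G)
      (λ { refl → w∉C }) (λ { refl → w∈W }) C⊆W
      λ { zero → let c , c∈C , w~c = C-neighbour in
                 w , c , w~c , refl , from (adjoin-zero (_∈? C) (λ _ → nothing)) c∈C }

  Model-mono : ∀ {m} {P Q : U.Pred (Fin n) 0ℓ} → (∀ {x} → P x → Q x) →
               Model G m P → Model G m Q
  Model-mono P⊆Q M = record
    { label     = label
    ; within    = P⊆Q ∘ within
    ; connected = connected
    ; touching  = touching
    }
    where open Model M

  mutual
    forest-oddSet : ∀ {V} → Acc _⊂_ V → ¬ Model G 3 (_∈ V) → OddSet V
    forest-oddSet {V} smaller no-triangle with nonempty? V
    ... | yes (_ , r∈V) =
      two-states⇒oddSet (forest-states smaller r∈V no-triangle)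
    ... | no  empty     = record
      { S           = V
      ; S⊆V         = id
      ; independent = λ x∈V → contradiction (_ , x∈V) empty
      ; odd         = λ x∈V → contradiction (_ , x∈V) empty
      }

    -- For a neighbour `w` of `r`, let `C` be the component of `w` in `V - r`. Without a triangle
    -- model only the edge from `r` to `w` joins `C` to `V ─ C`, so the states on the two parts can
    -- be joined. Once `r` is isolated, the rest is an independent forest problem.
    forest-states : ∀ {V r} → Acc _⊂_ V → r ∈ V → ¬ Model G 3 (_∈ V) →
                    TwoStates (Rooted V r)
    forest-states {V} {r} (acc smaller) r∈V no-triangle
      with any? (λ w → (w ∈? V) ×-dec (r ~? w))
    ... | no isolated =
      isolated-root r∈V (λ x∈V r~x → isolated (_ , x∈V , r~x))
        (forest-oddSet (smaller (x∈p⇒p-x⊂p r∈V))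
                       (no-triangle ∘ Model-mono (proj₁ ∘ x∈p-y⁻ V)))
    ... | yes (w , w∈V , r~w) =
      join-states (merge (p─q⊆p V C) C⊆V (Sum.swap ∘ ─-cover G)
                         (x∈p─q⇒x∉q V C) r∈V─C r∈C r~w only)
        (forest-states (smaller (p∩q≢∅⇒p─q⊂p V C (w , x∈p∩q⁺ (w∈V , r∈C)))) r∈V─C
                       (no-triangle ∘ Model-mono (p─q⊆p V C)))
        (forest-states (smaller (C⊆V , r , r∈V , r∉C)) r∈C
                       (no-triangle ∘ Model-mono C⊆V))
      where
      Δ = decompose G (V - r) (x∈p∧x≢y⇒x∈p-y w∈V (λ { refl → ~-irrefl refl r~w }))
      open Decomposition Δ using (C; C-path; closed; r∈C) renaming (C⊆V to C⊆V-r)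

      C⊆V : C ⊆ V
      C⊆V = proj₁ ∘ x∈p-y⁻ V ∘ C⊆V-r

      r∉C : r ∉ C
      r∉C r∈C = proj₂ (x∈p-y⁻ V (C⊆V-r r∈C)) refl

      r∈V─C : r ∈ V ─ C
      r∈V─C = x∈p∧x∉q⇒x∈p─q r∈V r∉C

      only : ∀ {x y} → x ∈ V ─ C → y ∈ C → x ~ y → x ≡ r × y ≡ w
      only {x} x∈ y∈C x~y with x ≟ r
      ... | yes refl =
        refl , unique-attachment no-triangle C⊆V-r r∈V C-path r∈C y∈C r~w x~y
      ... | no  x≢r  = contradiction
        (closed y∈C (x∈p∧x≢y⇒x∈p-y (p─q⊆p V C x∈) x≢r) (~-sym x~y))
        (x∈p─q⇒x∉q V C x∈)

  -- Induction on the number of colours.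

  oddSet⇒selection : ∀ {V} → OddSet V → Selection G 1 V
  oddSet⇒selection {V} σ = record
    { colour      = colour
    ; within      = λ {x} {i} eq → S⊆V (∈S {x} i eq)
    ; independent = λ {x} {y} {i} {j} cx cy → independent (∈S {x} i cx) (∈S {y} j cy)
    ; selects     = λ x∈V → zero , Parity-cong
        (mk⇔ (λ (nb , y∈S) → nb , from colour-zero y∈S)
             (λ (nb , cy) → nb , to colour-zero cy))
        (odd x∈V)
    }
    where
    open OddSet σ

    colour : Fin n → Maybe (Fin 1)
    colour = adjoin (_∈? S) (λ _ → nothing)

    colour-zero : ∀ {x} → colour x ≡ just zero ⇔ x ∈ S
    colour-zero = adjoin-zero (_∈? S) (λ _ → nothing)

    ∈S : ∀ {x} i → colour x ≡ just i → x ∈ S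
    ∈S zero eq = to colour-zero eq

  -- On the component `C` one colour is spent on the packing, and `L` has no model of order `m`, as
  -- it would extend to one of order `suc m` in `V`. The rest `V ─ C` reuses all the colours.
  selection-step : ∀ {k m V} →
    (∀ {W} → ¬ Model G m (_∈ W) → Selection G k W) →
    (∀ {W} → W ⊂ V → ¬ Model G (suc m) (_∈ W) → Selection G (suc k) W) →
    ¬ Model G (suc m) (_∈ V) → Selection G (suc k) V
  selection-step {V = V} fewer smaller no-model with nonempty? V
  ... | no  empty     = empty-selection G λ x∈V → empty (_ , x∈V)
  ... | yes (r , r∈V) =
    glue G C⊆V (p─q⊆p V C) (─-cover G) (─-separated G closed)
      (add-colour G Δ (fewer (no-model ∘ extend-L-model G Δ)))
      (smaller (p∩q≢∅⇒p─q⊂p V C (r , x∈p∩q⁺ (r∈V , r∈C)))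
               (no-model ∘ Model-mono (p─q⊆p V C)))
    where
    Δ = decompose G V r∈V
    open Decomposition Δ

  -- With `suc k` colours the excluded order is `k + 3`, so the base case excludes triangles.
  -- Passing to `L` lowers `k` and restarts the set induction; passing to `V ─ C` keeps `k` and
  -- shrinks the set.
  selection : ∀ k {V} → Acc _⊂_ V → ¬ Model G (suc k + 2) (_∈ V) →
              Selection G (suc k) V
  selection zero    smaller       = oddSet⇒selection ∘ forest-oddSet smaller
  selection (suc k) (acc smaller) = selection-step
    (selection k (⊂-wellFounded _)) (λ W⊂V → selection (suc k) (smaller W⊂V))

  selection⇒selector : ∀ {k} → Selection G k ⊤ → Selector Λodd k G
  selection⇒selector {k} σ = record
    { S           = S
    ; independent = λ x∈ y∈ → independent (proj₂ (to ∈S x∈)) (proj₂ (to ∈S y∈))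
    ; φ           = φ
    ; selects     = selected
    }
    where
    open Selection σ

    coloured? : U.Decidable (λ x → ∃ λ i → colour x ≡ just i)
    coloured? x with colour x
    ... | just i  = yes (i , refl)
    ... | nothing = no λ ()

    S : Subset n
    S = ⟦ coloured? ⟧

    ∈S : ∀ {x} → x ∈ S ⇔ (∃ λ i → colour x ≡ just i)
    ∈S = ∈⟦⟧ coloured?

    φ : Colouring S k
    φ x x∈S = proj₁ (to ∈S x∈S)

    ∈preimage : ∀ {x i} → x ∈ preimage φ i ⇔ colour x ≡ just i
    ∈preimage {x} {i} = mk⇔
      (λ x∈ → let x∈S , eq = to (∈⟦⟧ (preimage? φ i)) x∈ in
              trans (proj₂ (to ∈S x∈S)) (cong just eq))
      (λ cx → let x∈S = from ∈S (i , cx) in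
              from (∈⟦⟧ (preimage? φ i))
                (x∈S , just-injective (trans (sym (proj₂ (to ∈S x∈S))) cx)))

    selected : ∀ x → ∃ λ i → SizeSet.Member Λodd ∣ N[ G , x ] ∩ preimage φ i ∣
    selected x with selects {x} ∈⊤
    ... | i , p , ∈p , odd with odd-size p odd
    ...   | j , size = i , j , trans (cong ∣_∣ same) size
      where
      neighbour? : U.Decidable (Nb G x)
      neighbour? = Nb? G x

      same : N[ G , x ] ∩ preimage φ i ≡ p
      same = ⊆-antisym
        (λ y∈ → let y∈N , y∈φ = x∈p∩q⁻ N[ G , x ] (preimage φ i) y∈ in
                from ∈p (to (∈⟦⟧ neighbour?) y∈N , to ∈preimage y∈φ))
        (λ y∈ → let nb , cy = to ∈p y∈ in
                x∈p∩q⁺ (from (∈⟦⟧ neighbour?) nb , from ∈preimage cy))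

lemma2p8 : ∀ (k : ℕ) → 1 ≤ k → ∀ {n : ℕ} (G : Graph n) →
    ¬ (K (k + 2) ≼ G) → Selector Λodd k G
lemma2p8 (suc k) _ G no-minor =
  selection⇒selector G (selection G k (⊂-wellFounded ⊤) (no-minor ∘ model⇒≼ G))
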